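{- There exists a class of graphs for which the following holds: for every integer $r \ge 4$, there exists a graph $G$ in the class with $\varphi(G) = \hat{\varphi}(G) = 1$, whereas for every optimal coloring $c$ of $G$, $\varphi_c(G) = r-1$ and $\hat{\varphi}_c(G) = r-2$.
   Context: All graphs are finite, simple and undirected, with at least one vertex. $\chi$ denotes the chromatic number. For a proper vertex coloring $c$ of $G$ and an induced subgraph $H$ of $G$, let $c(H)$ be the set of colors used by $c$ on the vertices of $H$. Define $\varphi_c(G)=\max_{H}\,(|c(H)|-\chi(H))$ over all induced subgraphs $H$ of $G$, and $\hat{\varphi}_c(G)$ as the same maximum taken only over all connected induced subgraphs $H$ of $G$. Define $\varphi(G)=\min_c \varphi_c(G)$ and $\hat{\varphi}(G)=\min_c \hat{\varphi}_c(G)$, the minima over all proper colorings $c$ of $G$ (with any number of colors). An optimal coloring of $G$ is a proper coloring using exactly $\chi(G)$ colors. -}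

module Defs where

open import Data.Nat using (ℕ; NonZero; _∸_; _≤_)
open import Data.Nat.Properties using (_≟_)
open import Data.Fin using (Fin)
open import Data.List using (length; tabulate; deduplicate)
open import Data.Product using (Σ-syntax; _×_)
open import Data.Unit using (⊤)
open import Function using (_∘_)
open import Function.Definitions using (Injective)
open import Relation.Binary using (Rel; Symmetric; Irreflexive; Decidable)
open import Relation.Binary.PropositionalEquality using (_≡_; _≢_)
open import Relation.Binary.Construct.Closure.ReflexiveTransitive using (Star)
open import Level using (0ℓ)

record Graph : Set₁ where
  field
    order    : ℕ
    nonEmpty : NonZero order
  Vertex : Set
  Vertex = Fin order
  field
    Adj    : Rel Vertex 0ℓ
    adj?   : Decidable Adj
    symm   : Symmetric Adj
    irrefl : Irreflexive _≡_ Adj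

open Graph public using (Vertex; Adj)

GraphClass : Set₁
GraphClass = Graph → Set

Connected : Graph → Set
Connected G = ∀ (u v : Vertex G) → Star (Adj G) u v

-- An induced subgraph is given by an injective listing of its vertices, so a
-- vertex set of size m occurs m! times.  These copies are isomorphic and carry
-- the same colors, so maxima over induced subgraphs are unaffected.
record InducedSubgraph (G : Graph) : Set where
  field
    size      : ℕ
    nonEmpty  : NonZero size
    embed     : Fin size → Vertex G
    injective : Injective _≡_ _≡_ embed

  graph : Graph
  graph = record
    { order    = size
    ; nonEmpty = nonEmpty
    ; Adj      = λ u v → Adj G (embed u) (embed v)
    ; adj?     = λ u v → Graph.adj? G (embed u) (embed v)
    ; symm     = Graph.symm G
    ; irrefl   = λ { _≡_.refl → Graph.irrefl G _≡_.refl }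
    }

open InducedSubgraph public using (embed; graph)

-- Colors are arbitrary natural numbers, so the number of colors is not bounded
-- in advance.
record ProperColoring (G : Graph) : Set where
  field
    color  : Vertex G → ℕ
    proper : ∀ {u v} → Adj G u v → color u ≢ color v

open ProperColoring public using (color)

countValues : ∀ {n} → (Fin n → ℕ) → ℕ
countValues f = length (deduplicate _≟_ (tabulate f))

numColors : ∀ {G} → ProperColoring G → ℕ
numColors c = countValues (color c)

numColorsOn : ∀ {G} → ProperColoring G → InducedSubgraph G → ℕ
numColorsOn c H = countValues (color c ∘ embed H)

IsMinimum : (ℕ → Set) → ℕ → Set
IsMinimum P m = P m × (∀ k → P k → m ≤ k)

IsMaximum : (ℕ → Set) → ℕ → Set
IsMaximum P m = P m × (∀ k → P k → k ≤ m)

-- The graph parameters below are functional relations: "Param … k" reads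
-- "the parameter equals k".

Chromatic : Graph → ℕ → Set
Chromatic G = IsMinimum λ k → Σ[ c ∈ ProperColoring G ] numColors c ≡ k

Optimal : ∀ {G} → ProperColoring G → Set
Optimal {G} c = Chromatic G (numColors c)

-- The values |c(H)| − χ(H) for H ranging over the induced subgraphs satisfying
-- Q.  Truncated subtraction loses nothing: c restricts to a proper coloring of
-- H, so χ(H) ≤ |c(H)|.
Gap : (Graph → Set) → ∀ {G} → ProperColoring G → ℕ → Set
Gap Q {G} c d =
  Σ[ H ∈ InducedSubgraph G ] Σ[ k ∈ ℕ ]
    Q (graph H) × Chromatic (graph H) k × d ≡ numColorsOn c H ∸ k

φ-of : ∀ {G} → ProperColoring G → ℕ → Set
φ-of c = IsMaximum (Gap (λ _ → ⊤) c)

φ̂-of : ∀ {G} → ProperColoring G → ℕ → Set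
φ̂-of c = IsMaximum (Gap Connected c)

φ : Graph → ℕ → Set
φ G = IsMinimum λ m → Σ[ c ∈ ProperColoring G ] φ-of c m

φ̂ : Graph → ℕ → Set
φ̂ G = IsMinimum λ m → Σ[ c ∈ ProperColoring G ] φ̂-of c m

-- Take a clique v₁,…,v_r and an independent set w₁,…,w_r, with wᵢ adjacent to
-- every vⱼ except vᵢ.  In an r-coloring wᵢ must repeat the color of vᵢ, so the
-- wᵢ form a rainbow independent set on r colors and v₁,w₂,…,w_r a rainbow
-- star; as χ(H) ≥ 1, and χ(H) ≥ 2 for connected H with an edge, no induced
-- subgraph does better.  Spending one extra color on all of the wᵢ makes every
-- gap at most 1.  A gap of 1 is unavoidable: a coloring without a rainbow
-- induced path on three vertices gives v₁, w₁, w₂, v₂ the same color, although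
-- v₁ and v₂ are adjacent.
module Submission where

open import Data.Bool using (Bool; true; false)
open import Data.Empty using (⊥; ⊥-elim)
open import Data.Fin using (Fin; zero; suc; toℕ; splitAt; join)
open import Data.Fin.Patterns using (0F; 1F; 2F)
open import Data.Fin.Properties using (0≢1+n; injective⇒≤; join-splitAt; splitAt-join; suc-injective; toℕ-injective) renaming (_≟_ to _≟ᶠ_)
open import Data.List using (List; _∷_; allFin; deduplicate; length; lookup; map; tabulate)
open import Data.List.Membership.Propositional using (_∈_)
open import Data.List.Membership.Propositional.Properties using (∈-allFin; ∈-deduplicate⁺; ∈-deduplicate⁻; ∈-lookup; ∈-map⁺; ∈-tabulate⁺; ∈-tabulate⁻)
open import Data.List.Membership.Setoid.Properties using (index-injective)
open import Data.List.Properties using (length-map; length-tabulate)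
import Data.List.Relation.Unary.All as All
open import Data.List.Relation.Unary.AllPairs using (_∷_)
open import Data.List.Relation.Unary.Any using (here; there; index)
open import Data.List.Relation.Unary.Unique.DecPropositional.Properties using (deduplicate-!)
open import Data.List.Relation.Unary.Unique.Propositional using (Unique)
open import Data.Nat using (ℕ; zero; suc; NonZero; _+_; _∸_; _≤_; z≤n; s≤s)
open import Data.Nat.Properties using (_≟_; ≤-antisym; ≤-reflexive; ≤-trans; 1+n≰n; ∸-mono; ∸-monoˡ-≤; m≤n+o⇒m∸n≤o)
import Data.Nat.Properties as ℕ
open import Data.Product using (Σ-syntax; _×_; _,_; proj₁; proj₂)
open import Data.Sum using (_⊎_; inj₁; inj₂; [_,_]′)
open import Data.Unit using (⊤; tt)
open import Data.Vec.Functional using ([]) renaming (_∷_ to _∷ᶠ_)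
open import Function using (_∘_; id)
open import Function.Definitions using (Injective)
open import Relation.Binary using (Decidable; Symmetric)
open import Relation.Binary.Construct.Closure.ReflexiveTransitive using (ε; _◅_)
open import Relation.Binary.PropositionalEquality using (_≡_; _≢_; refl; sym; trans; cong; subst; subst₂; setoid; ≢-sym)
open import Relation.Nullary using (¬_; yes; no; ¬?)
open import Relation.Nullary.Decidable using (decidable-stable)
open import Defs

-- Counting the values of a function on a finite set.

Unique⇒lookup-injective : ∀ {A : Set} {xs : List A} → Unique xs → Injective _≡_ _≡_ (lookup xs)
Unique⇒lookup-injective (_ ∷ _)  {zero}  {zero}  _  = refl
Unique⇒lookup-injective (x∉ ∷ _) {zero}  {suc j} eq = ⊥-elim (All.lookup x∉ (∈-lookup j) eq)
Unique⇒lookup-injective (x∉ ∷ _) {suc i} {zero}  eq = ⊥-elim (All.lookup x∉ (∈-lookup i) (sym eq))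
Unique⇒lookup-injective (_ ∷ xs!) {suc i} {suc j} eq = cong suc (Unique⇒lookup-injective xs! eq)

values : ∀ {n} → (Fin n → ℕ) → List ℕ
values f = deduplicate _≟_ (tabulate f)

∈-values : ∀ {n} (f : Fin n → ℕ) i → f i ∈ values f
∈-values f i = ∈-deduplicate⁺ _≟_ (∈-tabulate⁺ i)

-- Each value of `f` is sent to the position in `ys` of `e` at a chosen preimage. Equal positions
-- force equal values of `e`, hence of `f`, so this map is injective.
countValues-factor : ∀ {n} {B : Set} (f : Fin n → ℕ) (e : Fin n → B) (ys : List B) →
                     (∀ i → e i ∈ ys) → (∀ {i j} → e i ≡ e j → f i ≡ f j) →
                     countValues f ≤ length ys
countValues-factor {n} f e ys e∈ys e⇒f = injective⇒≤ index∘pre-injective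
  where
  preimage : ∀ p → Σ[ i ∈ Fin n ] lookup (values f) p ≡ f i
  preimage p = ∈-tabulate⁻ (∈-deduplicate⁻ _≟_ (tabulate f) (∈-lookup p))

  pre : Fin (countValues f) → Fin n
  pre p = proj₁ (preimage p)

  index∘pre-injective : Injective _≡_ _≡_ (λ p → index (e∈ys (pre p)))
  index∘pre-injective {p} {q} eq = Unique⇒lookup-injective (deduplicate-! _≟_ (tabulate f))
    (trans (proj₂ (preimage p))
      (trans (e⇒f (index-injective (setoid _) (e∈ys (pre p)) (e∈ys (pre q)) eq))
        (sym (proj₂ (preimage q)))))

countValues-∈ : ∀ {n} (f : Fin n → ℕ) (ys : List ℕ) → (∀ i → f i ∈ ys) → countValues f ≤ length ys
countValues-∈ f ys f∈ys = countValues-factor f f ys f∈ys id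

countValues-kernel : ∀ {n} (f e : Fin n → ℕ) → (∀ {i j} → e i ≡ e j → f i ≡ f j) →
                     countValues f ≤ countValues e
countValues-kernel f e = countValues-factor f e (values e) (∈-values e)

countValues-finite : ∀ {n k} (f : Fin n → ℕ) (e : Fin n → Fin k) →
                     (∀ {i j} → e i ≡ e j → f i ≡ f j) → countValues f ≤ k
countValues-finite {k = k} f e e⇒f = subst (countValues f ≤_) (length-tabulate {n = k} id)
  (countValues-factor f e (allFin k) (λ i → ∈-allFin (e i)) e⇒f)

countValues-∘ : ∀ {m n} (f : Fin n → ℕ) (g : Fin m → Fin n) → countValues (f ∘ g) ≤ countValues f
countValues-∘ f g = countValues-∈ (f ∘ g) (values f) (λ i → ∈-values f (g i))

countValues-injective : ∀ {k n} (f : Fin n → ℕ) (g : Fin k → Fin n) →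
                        Injective _≡_ _≡_ (f ∘ g) → k ≤ countValues f
countValues-injective f g fg-inj = injective⇒≤ λ {i} {j} eq →
  fg-inj (index-injective (setoid ℕ) (∈-values f (g i)) (∈-values f (g j)) eq)

-- Cliques and lower bounds on the number of colors.

IsClique : ∀ G {k} → (Fin k → Vertex G) → Set
IsClique G g = ∀ i j → i ≢ j → Adj G (g i) (g j)

clique⇒injective : ∀ {G k} (c : ProperColoring G) {g : Fin k → Vertex G} → IsClique G g →
                   Injective _≡_ _≡_ (color c ∘ g)
clique⇒injective c clique {i} {j} eq =
  decidable-stable (i ≟ᶠ j) λ i≢j → ProperColoring.proper c (clique i j i≢j) eq

clique≤numColors : ∀ {G k} (c : ProperColoring G) (g : Fin k → Vertex G) → IsClique G g →
                   k ≤ numColors c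
clique≤numColors c g clique = countValues-injective (color c) g (clique⇒injective c clique)

singleton-clique : ∀ G (u : Vertex G) → IsClique G (u ∷ᶠ [])
singleton-clique G u zero zero i≢i = ⊥-elim (i≢i refl)

edge-clique : ∀ G {u v} → Adj G u v → IsClique G (u ∷ᶠ v ∷ᶠ [])
edge-clique G uv zero       zero       i≢i = ⊥-elim (i≢i refl)
edge-clique G uv zero       (suc zero) _   = uv
edge-clique G uv (suc zero) zero       _   = Graph.symm G uv
edge-clique G uv (suc zero) (suc zero) i≢i = ⊥-elim (i≢i refl)

someVertex : ∀ G → Vertex G
someVertex G = pick (Graph.order G) (Graph.nonEmpty G)
  where
  pick : ∀ n → NonZero n → Fin n
  pick (suc _) _ = zero

1≤numColors : ∀ {G} (c : ProperColoring G) → 1 ≤ numColors c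
1≤numColors {G} c = clique≤numColors c (someVertex G ∷ᶠ []) (singleton-clique G (someVertex G))

2≤numColors : ∀ {G} (c : ProperColoring G) {u v} → Adj G u v → 2 ≤ numColors c
2≤numColors {G} c {u} {v} uv = clique≤numColors c (u ∷ᶠ v ∷ᶠ []) (edge-clique G uv)

-- A walk between distinct vertices is not empty, and its first step is the edge. This is what
-- forces two colors on a connected graph with more than one vertex.
firstEdge : ∀ {G u v} → Connected G → u ≢ v → Σ[ x ∈ Vertex G ] Adj G u x
firstEdge {u = u} {v} conn u≢v with conn u v
... | ε      = ⊥-elim (u≢v refl)
... | ux ◅ _ = _ , ux

-- Gaps realized by rainbow subgraphs.

rainbow : ∀ {G} (c : ProperColoring G) (H : InducedSubgraph G) →
          Injective _≡_ _≡_ (color c ∘ embed H) → numColorsOn c H ≡ InducedSubgraph.size H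
rainbow c H inj = ≤-antisym (countValues-finite _ id (cong _)) (countValues-injective _ id inj)

connectedGap⇒gap : ∀ {G} (c : ProperColoring G) {d} → Gap Connected c d → Gap (λ _ → ⊤) c d
connectedGap⇒gap _ (H , k , _ , χ , eq) = H , k , tt , χ , eq

-- The m + 1 vertices carry m + 1 colors, while a constant coloring shows that the chromatic number
-- is 1.
rainbowIndependentSet : ∀ {G m} (c : ProperColoring G) (ℓ : Fin (suc m) → Vertex G) →
                        (∀ i j → ¬ Adj G (ℓ i) (ℓ j)) → Injective _≡_ _≡_ (color c ∘ ℓ) →
                        Gap (λ _ → ⊤) c m
rainbowIndependentSet {G} {m} c ℓ indep inj =
  H , 1 , tt , ((constant , numColors-constant) , λ { _ (d , refl) → 1≤numColors d }) ,
  cong (_∸ 1) (sym (rainbow c H inj))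
  where
  H : InducedSubgraph G
  H = record { size = suc m ; nonEmpty = _ ; embed = ℓ ; injective = inj ∘ cong (color c) }

  constant : ProperColoring (graph H)
  constant = record { color = λ _ → 0 ; proper = λ {i} {j} ij → ⊥-elim (indep i j ij) }

  numColors-constant : numColors constant ≡ 1
  numColors-constant = ≤-antisym (countValues-finite {k = 1} (color constant) (λ _ → zero) (λ _ → refl)) (1≤numColors constant)

-- Properness separates the center from the leaves, so the star shows m + 2 colors, and its
-- chromatic number is 2.
rainbowStar : ∀ {G m} (c : ProperColoring G) (b : Vertex G) (ℓ : Fin (suc m) → Vertex G) →
              (∀ i → Adj G b (ℓ i)) → (∀ i j → ¬ Adj G (ℓ i) (ℓ j)) →
              Injective _≡_ _≡_ (color c ∘ ℓ) → Gap Connected c m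
rainbowStar {G} {m} c b ℓ spoke indep ℓ-inj =
  H , 2 , connected ,
  ((bipartition , numColors-bipartition) , λ { _ (d , refl) → 2≤numColors d {zero} {suc zero} (spoke zero) }) ,
  cong (_∸ 2) (sym (rainbow c H inj))
  where
  inj : Injective _≡_ _≡_ (color c ∘ (b ∷ᶠ ℓ))
  inj {zero}  {zero}  _  = refl
  inj {zero}  {suc j} eq = ⊥-elim (ProperColoring.proper c (spoke j) eq)
  inj {suc i} {zero}  eq = ⊥-elim (ProperColoring.proper c (spoke i) (sym eq))
  inj {suc i} {suc j} eq = cong suc (ℓ-inj eq)

  H : InducedSubgraph G
  H = record { size = suc (suc m) ; nonEmpty = _ ; embed = b ∷ᶠ ℓ ; injective = inj ∘ cong (color c) }

  connected : Connected (graph H)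
  connected zero    zero    = ε
  connected zero    (suc j) = spoke j ◅ ε
  connected (suc i) zero    = Graph.symm G (spoke i) ◅ ε
  connected (suc i) (suc j) = _◅_ {j = zero} (Graph.symm G (spoke i)) (spoke j ◅ ε)

  side : Fin (suc (suc m)) → Fin 2
  side zero    = zero
  side (suc _) = suc zero

  side-proper : ∀ {i j} → Adj (graph H) i j → toℕ (side i) ≢ toℕ (side j)
  side-proper {zero}  {zero}  bb _ = Graph.irrefl G refl bb
  side-proper {suc i} {suc j} ij _ = indep i j ij

  bipartition : ProperColoring (graph H)
  bipartition = record { color = toℕ ∘ side ; proper = λ {i} {j} → side-proper {i} {j} }

  numColors-bipartition : numColors bipartition ≡ 2
  numColors-bipartition =
    ≤-antisym (countValues-finite _ side (cong toℕ)) (2≤numColors bipartition {zero} {suc zero} (spoke zero))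

rainbowPath : ∀ {G} (c : ProperColoring G) (a b x : Vertex G) → Adj G b a → Adj G b x →
              ¬ Adj G a x → color c a ≢ color c x → Gap Connected c 1
rainbowPath {G} c a b x ba bx ¬ax a≢x = rainbowStar c b (a ∷ᶠ x ∷ᶠ []) spoke indep inj
  where
  spoke : ∀ i → Adj G b ((a ∷ᶠ x ∷ᶠ []) i)
  spoke zero       = ba
  spoke (suc zero) = bx

  indep : ∀ i j → ¬ Adj G ((a ∷ᶠ x ∷ᶠ []) i) ((a ∷ᶠ x ∷ᶠ []) j)
  indep zero       zero       = Graph.irrefl G refl
  indep zero       (suc zero) = ¬ax
  indep (suc zero) zero       = ¬ax ∘ Graph.symm G
  indep (suc zero) (suc zero) = Graph.irrefl G refl

  inj : Injective _≡_ _≡_ (color c ∘ (a ∷ᶠ x ∷ᶠ []))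
  inj {zero}     {zero}     _  = refl
  inj {zero}     {suc zero} eq = ⊥-elim (a≢x eq)
  inj {suc zero} {zero}     eq = ⊥-elim (a≢x (sym eq))
  inj {suc zero} {suc zero} _  = refl

-- Upper bounds on gaps from the total number of colors.

gap≤ : ∀ {G} (c : ProperColoring G) {d} → Gap (λ _ → ⊤) c d → d ≤ numColors c ∸ 1
gap≤ c (H , _ , _ , ((e , refl) , _) , refl) =
  ∸-mono (countValues-∘ (color c) (embed H)) (1≤numColors e)

connectedGap≤ : ∀ {G} (c : ProperColoring G) {d} → Gap Connected c d → d ≤ numColors c ∸ 2
connectedGap≤ c (record { size = suc zero ; embed = h } , _ , _ , ((e , refl) , _) , refl) =
  -- A single vertex has chromatic number only 1, but it also shows only one color, so its gap is 0.
  ≤-trans (∸-mono (countValues-finite (color c ∘ h) id (cong _)) (1≤numColors e)) z≤n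
connectedGap≤ c (H@record { size = suc (suc _) } , _ , conn , ((e , refl) , _) , refl) =
  ∸-mono (countValues-∘ (color c) (embed H))
         (2≤numColors e (proj₂ (firstEdge {graph H} {zero} {suc zero} conn 0≢1+n)))

-- Split graphs and the twinned clique.

-- The class chosen for the theorem; `inK` is the indicator of the clique side, and its complement
-- is the independent side.
IsSplit : GraphClass
IsSplit G = Σ[ inK ∈ (Vertex G → Bool) ]
  (∀ u v → inK u ≡ true → inK v ≡ true → u ≢ v → Adj G u v) ×
  (∀ u v → inK u ≡ false → inK v ≡ false → ¬ Adj G u v)

module TwinnedClique (n : ℕ) where

  -- The offset makes the indices 0, 1 and 2 available, all of which occur in `connectedGap-1`.
  r : ℕ
  r = 3 + n

  -- inj₁ i is the clique vertex vᵢ and inj₂ i is its twin wᵢ.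
  Label : Set
  Label = Fin r ⊎ Fin r

  _~_ : Label → Label → Set
  inj₁ i ~ inj₁ j = i ≢ j
  inj₁ i ~ inj₂ j = i ≢ j
  inj₂ i ~ inj₁ j = i ≢ j
  inj₂ _ ~ inj₂ _ = ⊥

  ~-dec : Decidable _~_
  ~-dec (inj₁ i) (inj₁ j) = ¬? (i ≟ᶠ j)
  ~-dec (inj₁ i) (inj₂ j) = ¬? (i ≟ᶠ j)
  ~-dec (inj₂ i) (inj₁ j) = ¬? (i ≟ᶠ j)
  ~-dec (inj₂ _) (inj₂ _) = no id

  ~-sym : Symmetric _~_
  ~-sym {inj₁ _} {inj₁ _} = ≢-sym
  ~-sym {inj₁ _} {inj₂ _} = ≢-sym
  ~-sym {inj₂ _} {inj₁ _} = ≢-sym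

  ~-irrefl : ∀ s → ¬ (s ~ s)
  ~-irrefl (inj₁ _) i≢i = i≢i refl

  label : Fin (r + r) → Label
  label = splitAt r

  G : Graph
  G = record
    { order    = r + r
    ; nonEmpty = _
    ; Adj      = λ u v → label u ~ label v
    ; adj?     = λ u v → ~-dec (label u) (label v)
    ; symm     = λ {u} {v} → ~-sym {label u} {label v}
    ; irrefl   = λ { {u} refl → ~-irrefl (label u) }
    }

  vertex : Label → Vertex G
  vertex = join r r

  label-vertex : ∀ s → label (vertex s) ≡ s
  label-vertex = splitAt-join r r

  label-injective : ∀ {u v} → label u ≡ label v → u ≡ v
  label-injective {u} {v} eq =
    trans (sym (join-splitAt r r u)) (trans (cong vertex eq) (join-splitAt r r v))

  ~⇒Adj : ∀ {s t} → s ~ t → Adj G (vertex s) (vertex t)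
  ~⇒Adj {s} {t} = subst₂ _~_ (sym (label-vertex s)) (sym (label-vertex t))

  Adj⇒~ : ∀ {s t} → Adj G (vertex s) (vertex t) → s ~ t
  Adj⇒~ {s} {t} = subst₂ _~_ (label-vertex s) (label-vertex t)

  v w : Fin r → Vertex G
  v = vertex ∘ inj₁
  w = vertex ∘ inj₂

  v-clique : IsClique G v
  v-clique i j = ~⇒Adj {inj₁ i} {inj₁ j}

  vw-adj : ∀ i j → i ≢ j → Adj G (v i) (w j)
  vw-adj i j = ~⇒Adj {inj₁ i} {inj₂ j}

  vw-nonadj : ∀ i → ¬ Adj G (v i) (w i)
  vw-nonadj i vw = Adj⇒~ {inj₁ i} {inj₂ i} vw refl

  w-independent : ∀ i j → ¬ Adj G (w i) (w j)
  w-independent i j = Adj⇒~ {inj₂ i} {inj₂ j}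

  split : IsSplit G
  split = inK ∘ label , clique , independent
    where
    inK : Label → Bool
    inK = [ (λ _ → true) , (λ _ → false) ]′

    clique : ∀ x y → inK (label x) ≡ true → inK (label y) ≡ true → x ≢ y → Adj G x y
    clique x y x∈K y∈K x≢y = go (label x) (label y) x∈K y∈K (x≢y ∘ label-injective)
      where
      go : ∀ s t → inK s ≡ true → inK t ≡ true → s ≢ t → s ~ t
      go (inj₁ _) (inj₁ _) _ _ s≢t = s≢t ∘ cong inj₁

    independent : ∀ x y → inK (label x) ≡ false → inK (label y) ≡ false → ¬ Adj G x y
    independent x y = go (label x) (label y)
      where
      go : ∀ s t → inK s ≡ false → inK t ≡ false → ¬ (s ~ t)
      go (inj₂ _) (inj₂ _) _ _ = id

  -- Both parameters equal 1.

  -- The three compared pairs link v₀ to v₁. Each pair is nonadjacent and has a common neighbor, so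
  -- a difference in color yields a rainbow path.
  connectedGap-1 : (c : ProperColoring G) → Gap Connected c 1
  connectedGap-1 c with color c (v 0F) ≟ color c (w 0F) | color c (w 0F) ≟ color c (w 1F) | color c (v 1F) ≟ color c (w 1F)
  ... | no v₀≢w₀ | _ | _ =
    rainbowPath c (v 0F) (v 1F) (w 0F) (v-clique 1F 0F λ ()) (vw-adj 1F 0F λ ()) (vw-nonadj 0F) v₀≢w₀
  ... | yes _ | no w₀≢w₁ | _ =
    -- A common neighbor of w₀ and w₁ must be some vⱼ with j different from 0 and 1, hence the third
    -- index.
    rainbowPath c (w 0F) (v 2F) (w 1F) (vw-adj 2F 0F λ ()) (vw-adj 2F 1F λ ()) (w-independent 0F 1F) w₀≢w₁
  ... | yes _ | yes _ | no v₁≢w₁ =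
    rainbowPath c (v 1F) (v 0F) (w 1F) (v-clique 0F 1F λ ()) (vw-adj 0F 1F λ ()) (vw-nonadj 1F) v₁≢w₁
  ... | yes v₀≡w₀ | yes w₀≡w₁ | yes v₁≡w₁ =
    ⊥-elim (ProperColoring.proper c (v-clique 0F 1F λ ()) (trans v₀≡w₀ (trans w₀≡w₁ (sym v₁≡w₁))))

  extraColor : Label → ℕ
  extraColor = [ suc ∘ toℕ , (λ _ → 0) ]′

  extraColor-proper : ∀ s t → s ~ t → extraColor s ≢ extraColor t
  extraColor-proper (inj₁ _) (inj₁ _) i≢j eq = i≢j (toℕ-injective (ℕ.suc-injective eq))
  extraColor-proper (inj₁ _) (inj₂ _) _ ()
  extraColor-proper (inj₂ _) (inj₁ _) _ ()

  extraColoring : ProperColoring G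
  extraColoring = record
    { color  = extraColor ∘ label
    ; proper = λ {x} {y} → extraColor-proper (label x) (label y)
    }

  -- A coloring d of H, recolored by 0 on the wᵢ, identifies no more vertices
  -- than extraColoring does, and it uses at most one color more than d.
  extraColoring-gap≤1 : ∀ {d} → Gap (λ _ → ⊤) extraColoring d → d ≤ 1
  extraColoring-gap≤1 (H , _ , _ , ((d , refl) , _) , refl) =
    m≤n+o⇒m∸n≤o _ _ (≤-trans (countValues-kernel (extraColor ∘ ℓ) recolored (refines _ _))
      (≤-trans (countValues-∈ recolored (0 ∷ map suc (values (color d))) recolored∈)
        (≤-reflexive (trans (cong suc (length-map suc (values (color d)))) (ℕ.+-comm 1 _)))))
    where
    ℓ : Vertex (graph H) → Label
    ℓ = label ∘ embed H

    recolor : Label → ℕ → ℕ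
    recolor (inj₁ _) k = suc k
    recolor (inj₂ _) _ = 0

    recolored : Vertex (graph H) → ℕ
    recolored x = recolor (ℓ x) (color d x)

    recolored∈ : ∀ x → recolored x ∈ 0 ∷ map suc (values (color d))
    recolored∈ x with ℓ x
    ... | inj₁ _ = there (∈-map⁺ suc (∈-values (color d) x))
    ... | inj₂ _ = here refl

    -- Clique vertices that agree after recoloring agree under `d`, so they are nonadjacent and
    -- therefore equal. Mixed pairs never agree, since 0 is not a successor.
    recolor-refines : ∀ s t {k l} → (s ~ t → k ≢ l) → recolor s k ≡ recolor t l → extraColor s ≡ extraColor t
    recolor-refines (inj₁ i) (inj₁ j) k≢l eq =
      cong (suc ∘ toℕ) (decidable-stable (i ≟ᶠ j) λ i≢j → k≢l i≢j (ℕ.suc-injective eq))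
    recolor-refines (inj₂ _) (inj₂ _) _   _  = refl

    refines : ∀ x y → recolored x ≡ recolored y → extraColor (ℓ x) ≡ extraColor (ℓ y)
    refines x y = recolor-refines (ℓ x) (ℓ y) (ProperColoring.proper d)

  -- The connected gap of 1 serves twice: it bounds every coloring from below, and it shows that
  -- `extraColoring` attains its upper bound.
  φ≡1 : φ G 1
  φ≡1 = (extraColoring , connectedGap⇒gap extraColoring (connectedGap-1 extraColoring) , λ _ → extraColoring-gap≤1) ,
        λ { _ (c , _ , upper) → upper 1 (connectedGap⇒gap c (connectedGap-1 c)) }

  φ̂≡1 : φ̂ G 1
  φ̂≡1 = (extraColoring , connectedGap-1 extraColoring , λ _ → extraColoring-gap≤1 ∘ connectedGap⇒gap extraColoring) ,
        λ { _ (c , _ , upper) → upper 1 (connectedGap-1 c) }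

  -- Optimal colorings of the twinned clique.

  -- A witness that r colors suffice: vᵢ and wᵢ share the color i.
  twinColoring : ProperColoring G
  twinColoring = record { color = toℕ ∘ position ∘ label ; proper = λ {x} {y} → proper (label x) (label y) }
    where
    position : Label → Fin r
    position = [ id , id ]′

    proper : ∀ s t → s ~ t → toℕ (position s) ≢ toℕ (position t)
    proper (inj₁ _) (inj₁ _) i≢j = i≢j ∘ toℕ-injective
    proper (inj₁ _) (inj₂ _) i≢j = i≢j ∘ toℕ-injective
    proper (inj₂ _) (inj₁ _) i≢j = i≢j ∘ toℕ-injective

  optimal⇒≤r : (c : ProperColoring G) → Optimal c → numColors c ≤ r
  optimal⇒≤r c (_ , least) = ≤-trans (least _ (twinColoring , refl))
    (countValues-finite (color twinColoring) ([ id , id ]′ ∘ label) (cong toℕ))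

  module _ (c : ProperColoring G) (≤r : numColors c ≤ r) where

    -- Since wᵢ is adjacent to every other vⱼ, a color different from that of vᵢ would be new to the
    -- whole clique, giving r + 1 colors.
    twins-agree : ∀ i → color c (w i) ≡ color c (v i)
    twins-agree i = decidable-stable (color c (w i) ≟ color c (v i)) λ wᵢ≢vᵢ →
      1+n≰n (≤-trans (countValues-injective (color c) (w i ∷ᶠ v) (rainbow-∷ wᵢ≢vᵢ)) ≤r)
      where
      wᵢ≢v : color c (w i) ≢ color c (v i) → ∀ j → color c (w i) ≢ color c (v j)
      wᵢ≢v wᵢ≢vᵢ j with j ≟ᶠ i
      ... | yes refl = wᵢ≢vᵢ
      ... | no j≢i   = ≢-sym (ProperColoring.proper c (vw-adj j i j≢i))

      rainbow-∷ : color c (w i) ≢ color c (v i) → Injective _≡_ _≡_ (color c ∘ (w i ∷ᶠ v))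
      rainbow-∷ wᵢ≢vᵢ {zero}  {zero}  _  = refl
      rainbow-∷ wᵢ≢vᵢ {zero}  {suc k} eq = ⊥-elim (wᵢ≢v wᵢ≢vᵢ k eq)
      rainbow-∷ wᵢ≢vᵢ {suc j} {zero}  eq = ⊥-elim (wᵢ≢v wᵢ≢vᵢ j (sym eq))
      rainbow-∷ wᵢ≢vᵢ {suc j} {suc k} eq = cong suc (clique⇒injective c v-clique eq)

    w-rainbow : Injective _≡_ _≡_ (color c ∘ w)
    w-rainbow {i} {j} eq =
      clique⇒injective c v-clique (trans (sym (twins-agree i)) (trans eq (twins-agree j)))

    φ-of≡r∸1 : φ-of c (r ∸ 1)
    φ-of≡r∸1 = rainbowIndependentSet c w w-independent w-rainbow ,
               λ _ gap → ≤-trans (gap≤ c gap) (∸-monoˡ-≤ 1 ≤r)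

    φ̂-of≡r∸2 : φ̂-of c (r ∸ 2)
    -- The center v₀ is adjacent to every wᵢ except w₀, which leaves r - 1 leaves: r colors on the
    -- star, minus 2.
    φ̂-of≡r∸2 = rainbowStar c (v zero) (w ∘ suc) (λ i → vw-adj zero (suc i) λ ()) (λ i j → w-independent (suc i) (suc j))
                 (suc-injective ∘ w-rainbow) ,
               λ _ gap → ≤-trans (connectedGap≤ c gap) (∸-monoˡ-≤ 2 ≤r)

theorem7p1 : Σ[ 𝒞 ∈ GraphClass ]
    (∀ (r : ℕ) → 4 ≤ r →
    Σ[ G ∈ Graph ]
    (𝒞 G × φ G 1 × φ̂ G 1 ×
    (∀ (c : ProperColoring G) → Optimal c →
    φ-of c (r ∸ 1) × φ̂-of c (r ∸ 2))))
theorem7p1 = IsSplit , λ where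
  -- The pattern writes the given integer as 3 + n, the clique size in `TwinnedClique n`.
  (suc (suc (suc n))) (s≤s (s≤s (s≤s _))) →
    let open TwinnedClique n in
    G , split , φ≡1 , φ̂≡1 , λ c opt →
      φ-of≡r∸1 c (optimal⇒≤r c opt) , φ̂-of≡r∸2 c (optimal⇒≤r c opt)
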